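{- For each $c>0$ and integer $d\ge1$ there exists a constant $C'(d,c)=2^{O_c(d^3)}$ such that the following holds for all integers $d\le k\le n$. Let $Y\subseteq\binom{[n]}{k}$ and $B\subseteq\binom{[n]}{d}$ satisfy $$\Pr_{S\sim\nu_n(k)}[S\in Y\mid S\supseteq I]\ge c\quad\text{for all } I\in B.$$ Then $$\Pr_{S\sim\nu_n(k)}[S\text{ hits }B]\le C'(d,c)\cdot\Pr_{S\sim\nu_n(k)}[S\in Y].$$
   Context: $[n]=\{1,\dots,n\}$; $\binom{[n]}{k}$ is the set of $k$-element subsets of $[n]$, and $\nu_n(k)$ is the uniform distribution on it. A set $S$ hits $B$ if $S\supseteq I$ for some $I\in B$. The notation $2^{O_c(d^3)}$ means an upper bound $2^{A d^3}$ where $A$ depends only on $c$. -}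

module Defs where

open import Data.Fin.Subset using (Subset; inside; outside; ∣_∣; _⊆_; _⊇_)
open import Data.Fin.Subset.Properties using (_⊆?_; anySubset?)
open import Data.Integer using (+_)
open import Data.List using (List; []; _∷_; _++_; map; filter; length)
open import Data.Nat using (ℕ; zero; suc)
import Data.Nat as ℕ
open import Data.Product using (∃; ∃-syntax; _×_)
open import Data.Rational using (ℚ; 0ℚ; _/_; _÷_; _<_; _≟_; ≢-nonZero)
open import Data.Sum using (_⊎_)
open import Data.Vec using ([]; _∷_)
open import Level using (0ℓ)
open import Relation.Binary.PropositionalEquality using (_≡_)
open import Relation.Nullary using (¬_; yes; no)
open import Relation.Nullary.Decidable using (_×-dec_)
open import Relation.Unary using (Pred; Decidable; _∈_)
open import Relation.Unary.Properties using (_∩?_)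

-- Real numbers as two-sided Dedekind cuts: lower holds the rationals strictly
-- below the real, upper those strictly above.
record ℝ : Set₁ where
  field
    lower upper       : Pred ℚ 0ℓ
    lower-inhabited   : ∃[ q ] q ∈ lower
    upper-inhabited   : ∃[ q ] q ∈ upper
    lower-closed      : ∀ {p q} → p < q → q ∈ lower → p ∈ lower
    upper-closed      : ∀ {p q} → p < q → p ∈ upper → q ∈ upper
    lower-open        : ∀ {p} → p ∈ lower → ∃[ q ] (p < q × q ∈ lower)
    upper-open        : ∀ {q} → q ∈ upper → ∃[ p ] (p < q × p ∈ upper)
    disjoint          : ∀ {q} → q ∈ lower → ¬ (q ∈ upper)
    located           : ∀ {p q} → p < q → p ∈ lower ⊎ q ∈ upper

open ℝ public using (lower; upper)

Positive : ℝ → Set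
Positive x = 0ℚ ∈ lower x

infix 4 _≥ᴿ_

_≥ᴿ_ : ℚ → ℝ → Set
q ≥ᴿ x = ¬ (q ∈ lower x)

fromℕ : ℕ → ℚ
fromℕ m = + m / 1

-- Division made total by x /₀ 0 = 0.  Below, the denominators are the number
-- of k-subsets of [n] and the probability that S ⊇ I; both are nonzero when
-- ∣ I ∣ ≤ k ≤ n.
infixl 7 _/₀_

_/₀_ : ℚ → ℚ → ℚ
p /₀ q with q ≟ 0ℚ
... | yes _   = 0ℚ
... | no  q≢0 = (p ÷ q) {{≢-nonZero q≢0}}

-- Each subset of [n], exactly once.
subsets : ∀ n → List (Subset n)
subsets zero    = [] ∷ []
subsets (suc n) = map (inside ∷_) (subsets n) ++ map (outside ∷_) (subsets n)

kSubsets : ∀ n → ℕ → List (Subset n)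
kSubsets n k = filter (λ S → ∣ S ∣ ℕ.≟ k) (subsets n)

Pr : ∀ n → ℕ → {E : Pred (Subset n) 0ℓ} → Decidable E → ℚ
Pr n k E? = fromℕ (length (filter E? (kSubsets n k))) /₀ fromℕ (length (kSubsets n k))

CondPr : ∀ n → ℕ → {E F : Pred (Subset n) 0ℓ} → Decidable E → Decidable F → ℚ
CondPr n k E? F? = Pr n k (E? ∩? F?) /₀ Pr n k F?

-- A set of k-subsets of [n].  Membership is decidable, as it always is
-- classically, so that elements can be counted.
record Family (n k : ℕ) : Set₁ where
  field
    Member  : Pred (Subset n) 0ℓ
    member? : Decidable Member
    uniform : ∀ {S} → S ∈ Member → ∣ S ∣ ≡ k

open Family public

Hits : ∀ {n d} → Family n d → Pred (Subset n) 0ℓ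
Hits B S = ∃[ I ] (I ∈ Member B × S ⊇ I)

hits? : ∀ {n d} (B : Family n d) → Decidable (Hits B)
hits? B S = anySubset? (λ I → member? B I ×-dec (I ⊆? S))

{-# OPTIONS --safe #-}

-- Write N(J) for the number of k-sets containing J.  Greedily build a multiset W of edges of
-- B that is maximal subject to load(J) = #{I ∈ W : J ⊆ I} ≤ N(J) for every J.  By maximality
-- every edge of B contains a tight J, so a union bound over the tight sets gives
--     #(k-sets hitting B) ≤ Σ_{J tight} N(J) ≤ Σ_J load(J) = 2^d |W|.
-- Let f(S) = #{I ∈ W : I ⊆ S} and D = N(I) for ∣ I ∣ = d.  Grouping pairs of edges by their
-- intersection J, the bound load(J) ≤ N(J) and the log-concavity N(I ∪ I′) N(I ∩ I′) ≤ D²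
-- give Σ_S f(S)² ≤ 2^d |W| D², while density of Y above each edge gives a Σ_{S ∈ Y} f(S) ≥ |W| D
-- for any natural number a ≥ 1/c.  By Cauchy–Schwarz |W| ≤ a² 2^d |Y|, so C′ = a² 4^d works.

module Submission where

open import Defs
open import Data.Bool using (if_then_else_)
open import Data.Fin.Subset using (Subset; inside; outside; ∣_∣; _⊆_; _∩_; _∪_; ∁)
open import Data.Fin.Subset.Properties
  using (_⊆?_; drop-∷-⊆; out⊆; in⊆in; ⊆-trans; p∩q⊆p; p∩q⊆q; p⊆p∪q; q⊆p∪q;
         x∈p∪q⁻; p⊆q⇒∣p∣≤∣q∣; p⊆q⇒∁p⊇∁q; ∣∁p∣≡n∸∣p∣; ∣p∣≤n)
import Data.Integer as ℤ
import Data.Integer.Properties as ℤ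
open import Data.List using (List; []; _∷_; _++_; map; filter; length; replicate)
open import Data.List.Extrema.Nat using (argmin; argmin-all; f[argmin]≤f[xs])
open import Data.List.Membership.Propositional using () renaming (_∈_ to _∈ˡ_)
open import Data.List.Membership.Propositional.Properties
  using (∈-++⁺ˡ; ∈-++⁺ʳ; ∈-map⁺; ∈-filter⁺)
open import Data.List.Relation.Unary.All using (All; []; _∷_)
import Data.List.Relation.Unary.All as All
import Data.List.Relation.Unary.All.Properties as All
open import Data.List.Relation.Unary.Any using (here; there)
open import Data.Nat using (ℕ; zero; suc; _^_)
import Data.Nat as ℕ
open import Data.Nat.Combinatorics using (_C_; nCk+nC[k+1]≡[n+1]C[k+1])
import Data.Nat.Properties as ℕ
open import Data.Nat.Tactic.RingSolver using (solve-∀)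
open import Data.Product using (∃-syntax; _×_; _,_; proj₁; proj₂)
open import Data.Rational using (ℚ; 0ℚ; 1ℚ; mkℚ; _≤_; _<_; _*_; _≟_; 1/_; toℚᵘ; ≢-nonZero)
import Data.Rational as ℚ
import Data.Rational.Properties as ℚ
import Data.Rational.Unnormalised as ℚᵘ
import Data.Rational.Unnormalised.Properties as ℚᵘ
open import Data.Sum using (inj₁; inj₂; [_,_]′)
open import Data.Vec using ([]; _∷_)
open import Function using (_∘_; _⇔_; mk⇔; Equivalence)
open import Level using (0ℓ)
open import Relation.Binary.PropositionalEquality
  using (_≡_; _≢_; refl; sym; trans; cong; cong₂; subst; subst₂; module ≡-Reasoning)
open import Relation.Nullary using (¬_; Dec; yes; no; does; contradiction)
open import Relation.Nullary.Decidable using (_×-dec_)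
open import Relation.Unary using (Pred; Decidable; _∈_)
open import Relation.Unary.Properties using (_∩?_)

private
  variable
    X Z : Set
    n : ℕ

-- Indicators and finite sums

⟦_⟧ : Dec X → ℕ
⟦ x? ⟧ = if does x? then 1 else 0

⟦⟧-yes : (x? : Dec X) → X → ⟦ x? ⟧ ≡ 1
⟦⟧-yes (yes _) _ = refl
⟦⟧-yes (no ¬x) x = contradiction x ¬x

⟦⟧-no : (x? : Dec X) → ¬ X → ⟦ x? ⟧ ≡ 0
⟦⟧-no (yes x) ¬x = contradiction x ¬x
⟦⟧-no (no _)  _  = refl

⟦⟧-⇔ : (x? : Dec X) (z? : Dec Z) → X ⇔ Z → ⟦ x? ⟧ ≡ ⟦ z? ⟧
⟦⟧-⇔ (yes x) z? e = sym (⟦⟧-yes z? (Equivalence.to e x))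
⟦⟧-⇔ (no ¬x) z? e = sym (⟦⟧-no z? (¬x ∘ Equivalence.from e))

⟦⟧-× : (x? : Dec X) (z? : Dec Z) → ⟦ x? ×-dec z? ⟧ ≡ ⟦ x? ⟧ ℕ.* ⟦ z? ⟧
⟦⟧-× (yes _) (yes _) = refl
⟦⟧-× (yes _) (no _)  = refl
⟦⟧-× (no _)  _       = refl

⟦⟧-*-≤ : ∀ (x? : Dec X) {m o} → (X → m ℕ.≤ o) → ⟦ x? ⟧ ℕ.* m ℕ.≤ o
⟦⟧-*-≤ (yes x) m≤o = ℕ.≤-trans (ℕ.≤-reflexive (ℕ.*-identityˡ _)) (m≤o x)
⟦⟧-*-≤ (no _)  m≤o = ℕ.z≤n

∑ : List X → (X → ℕ) → ℕ
∑ []       f = 0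
∑ (x ∷ xs) f = f x ℕ.+ ∑ xs f

∑-cong : ∀ (xs : List X) {f g} → (∀ x → f x ≡ g x) → ∑ xs f ≡ ∑ xs g
∑-cong []       f≡g = refl
∑-cong (x ∷ xs) f≡g = cong₂ ℕ._+_ (f≡g x) (∑-cong xs f≡g)

∑-mono-All : ∀ {xs : List X} {f g} → All (λ x → f x ℕ.≤ g x) xs → ∑ xs f ℕ.≤ ∑ xs g
∑-mono-All []         = ℕ.z≤n
∑-mono-All (px ∷ pxs) = ℕ.+-mono-≤ px (∑-mono-All pxs)

∑-mono : ∀ (xs : List X) {f g} → (∀ x → f x ℕ.≤ g x) → ∑ xs f ℕ.≤ ∑ xs g
∑-mono xs f≤g = ∑-mono-All (All.universal f≤g xs)

∑-++ : ∀ (xs {ys} : List X) {f} → ∑ (xs ++ ys) f ≡ ∑ xs f ℕ.+ ∑ ys f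
∑-++ []           = refl
∑-++ (x ∷ xs) {f = f} = trans (cong (f x ℕ.+_) (∑-++ xs)) (sym (ℕ.+-assoc (f x) _ _))

∑-map : ∀ (h : X → Z) xs {f} → ∑ (map h xs) f ≡ ∑ xs (f ∘ h)
∑-map h []           = refl
∑-map h (x ∷ xs) {f} = cong (f (h x) ℕ.+_) (∑-map h xs)

∑-replicate : ∀ w {x : X} {f} → ∑ (replicate w x) f ≡ w ℕ.* f x
∑-replicate zero            = refl
∑-replicate (suc w) {f = f} = cong (f _ ℕ.+_) (∑-replicate w)

∑-const : ∀ (xs : List X) m → ∑ xs (λ _ → m) ≡ length xs ℕ.* m
∑-const []       m = refl
∑-const (x ∷ xs) m = cong (m ℕ.+_) (∑-const xs m)

∑-zero : ∀ (xs : List X) → ∑ xs (λ _ → 0) ≡ 0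
∑-zero xs = trans (∑-const xs 0) (ℕ.*-zeroʳ (length xs))

∑-+ : ∀ (xs : List X) f g → ∑ xs (λ x → f x ℕ.+ g x) ≡ ∑ xs f ℕ.+ ∑ xs g
∑-+ []       f g = refl
∑-+ (x ∷ xs) f g rewrite ∑-+ xs f g = interchange (f x) (g x) (∑ xs f) (∑ xs g)
  where
  interchange : ∀ a b c d → (a ℕ.+ b) ℕ.+ (c ℕ.+ d) ≡ (a ℕ.+ c) ℕ.+ (b ℕ.+ d)
  interchange = solve-∀

∑-*ˡ : ∀ m (xs : List X) f → ∑ xs (λ x → m ℕ.* f x) ≡ m ℕ.* ∑ xs f
∑-*ˡ m []       f = sym (ℕ.*-zeroʳ m)
∑-*ˡ m (x ∷ xs) f rewrite ∑-*ˡ m xs f = sym (ℕ.*-distribˡ-+ m (f x) (∑ xs f))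

∑-*ʳ : ∀ (xs : List X) f m → ∑ xs (λ x → f x ℕ.* m) ≡ ∑ xs f ℕ.* m
∑-*ʳ xs f m =
  trans (∑-cong xs (λ x → ℕ.*-comm (f x) m)) (trans (∑-*ˡ m xs f) (ℕ.*-comm m _))

∑-swap : ∀ (xs : List X) (zs : List Z) (f : X → Z → ℕ) →
         ∑ xs (λ x → ∑ zs (f x)) ≡ ∑ zs (λ z → ∑ xs (λ x → f x z))
∑-swap []       zs f = sym (∑-zero zs)
∑-swap (x ∷ xs) zs f rewrite ∑-swap xs zs f = sym (∑-+ zs (f x) _)

∑-* : ∀ (xs : List X) (zs : List Z) f g →
      ∑ xs f ℕ.* ∑ zs g ≡ ∑ xs (λ x → ∑ zs (λ z → f x ℕ.* g z))
∑-* xs zs f g =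
  trans (sym (∑-*ʳ xs f (∑ zs g))) (∑-cong xs (λ x → sym (∑-*ˡ (f x) zs g)))

≤-∑ : ∀ {xs : List X} {x} f → x ∈ˡ xs → f x ℕ.≤ ∑ xs f
≤-∑ {xs = _ ∷ xs} f (here refl)  = ℕ.m≤m+n _ (∑ xs f)
≤-∑ {xs = y ∷ _}  f (there x∈xs) = ℕ.≤-trans (≤-∑ f x∈xs) (ℕ.m≤n+m _ (f y))

∑-filter : ∀ {P : Pred X 0ℓ} (P? : Decidable P) xs f →
           ∑ (filter P? xs) f ≡ ∑ xs (λ x → ⟦ P? x ⟧ ℕ.* f x)
∑-filter P? []       f = refl
∑-filter P? (x ∷ xs) f with P? x
... | yes _ = cong₂ ℕ._+_ (sym (ℕ.+-identityʳ (f x))) (∑-filter P? xs f)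
... | no  _ = ∑-filter P? xs f

length-filter : ∀ {P : Pred X 0ℓ} (P? : Decidable P) xs →
                length (filter P? xs) ≡ ∑ xs (λ x → ⟦ P? x ⟧)
length-filter P? []       = refl
length-filter P? (x ∷ xs) with P? x
... | yes _ = cong suc (length-filter P? xs)
... | no  _ = length-filter P? xs

-- Binomial coefficients

-- Induction on `m` by Pascal's rule: setting one copy of `u` aside leaves two terms to which the
-- hypotheses at `e` and `suc e` apply, with common factor `suc m`.
absorption : ∀ m e → suc e ℕ.* (suc m C suc e) ≡ suc m ℕ.* (m C e)
absorption zero    zero    = refl
absorption zero    (suc e) = ℕ.*-zeroʳ (suc (suc e))
absorption (suc m) zero    =
  trans (cong (1 ℕ.*_) (sym (nCk+nC[k+1]≡[n+1]C[k+1] (suc m) 0)))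
    (trans (cong (λ z → 1 ℕ.* (1 ℕ.+ z)) (trans (sym (ℕ.*-identityˡ _)) (absorption m 0)))
           (identity m))
  where
  identity : ∀ m → 1 ℕ.* (1 ℕ.+ suc m ℕ.* 1) ≡ suc (suc m) ℕ.* 1
  identity = solve-∀
absorption (suc m) (suc e) = begin
  suc (suc e) ℕ.* (suc (suc m) C suc (suc e))
    ≡⟨ cong (suc (suc e) ℕ.*_) (sym (nCk+nC[k+1]≡[n+1]C[k+1] (suc m) (suc e))) ⟩
  suc (suc e) ℕ.* (u ℕ.+ v)
    ≡⟨ split e u v ⟩
  u ℕ.+ (suc e ℕ.* u ℕ.+ suc (suc e) ℕ.* v)
    ≡⟨ cong (u ℕ.+_) (cong₂ ℕ._+_ (absorption m e) (absorption m (suc e))) ⟩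
  u ℕ.+ (suc m ℕ.* (m C e) ℕ.+ suc m ℕ.* (m C suc e))
    ≡⟨ cong (u ℕ.+_) (sym (ℕ.*-distribˡ-+ (suc m) (m C e) _)) ⟩
  u ℕ.+ suc m ℕ.* (m C e ℕ.+ m C suc e)
    ≡⟨ cong (λ z → u ℕ.+ suc m ℕ.* z) (nCk+nC[k+1]≡[n+1]C[k+1] m e) ⟩
  suc (suc m) ℕ.* u ∎
  where
  open ≡-Reasoning
  u = suc m C suc e
  v = suc m C suc (suc e)
  split : ∀ e u v → suc (suc e) ℕ.* (u ℕ.+ v) ≡ u ℕ.+ (suc e ℕ.* u ℕ.+ suc (suc e) ℕ.* v)
  split = solve-∀

-- The quotient of `m C suc e` by `m C e` is `(m - e) / (e + 1)`, which grows with `m`. Adding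
-- `suc e * (a * a′)` to both sides avoids the subtraction: by `absorption` the claim becomes
-- `suc m * a * a′ ≤ suc m′ * a * a′`.
C-ratio-mono : ∀ e {m m′} → m ℕ.≤ m′ →
               (m C suc e) ℕ.* (m′ C e) ℕ.≤ (m C e) ℕ.* (m′ C suc e)
C-ratio-mono e {m} {m′} m≤m′ =
  ℕ.*-cancelˡ-≤ (suc e) (ℕ.+-cancelʳ-≤ (suc e ℕ.* (a ℕ.* a′)) _ _ (begin
    suc e ℕ.* (b ℕ.* a′) ℕ.+ suc e ℕ.* (a ℕ.* a′)  ≡⟨ left (suc e) a b a′ ⟩
    suc e ℕ.* (a ℕ.+ b) ℕ.* a′                     ≡⟨ cong (ℕ._* a′) (step m) ⟩
    suc m ℕ.* a ℕ.* a′                             ≤⟨ ℕ.*-monoˡ-≤ a′ (ℕ.*-monoˡ-≤ a (ℕ.s≤s m≤m′)) ⟩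
    suc m′ ℕ.* a ℕ.* a′                            ≡⟨ shuffle (suc m′) a a′ ⟩
    a ℕ.* (suc m′ ℕ.* a′)                          ≡⟨ cong (a ℕ.*_) (sym (step m′)) ⟩
    a ℕ.* (suc e ℕ.* (a′ ℕ.+ b′))                  ≡⟨ right (suc e) a a′ b′ ⟩
    suc e ℕ.* (a ℕ.* b′) ℕ.+ suc e ℕ.* (a ℕ.* a′)  ∎))
  where
  open ℕ.≤-Reasoning
  a  = m C e
  b  = m C suc e
  a′ = m′ C e
  b′ = m′ C suc e
  step : ∀ m → suc e ℕ.* (m C e ℕ.+ m C suc e) ≡ suc m ℕ.* (m C e)
  step m = trans (cong (suc e ℕ.*_) (nCk+nC[k+1]≡[n+1]C[k+1] m e)) (absorption m e)
  left : ∀ s a b a′ → s ℕ.* (b ℕ.* a′) ℕ.+ s ℕ.* (a ℕ.* a′) ≡ s ℕ.* (a ℕ.+ b) ℕ.* a′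
  left = solve-∀
  shuffle : ∀ s a a′ → s ℕ.* a ℕ.* a′ ≡ a ℕ.* (s ℕ.* a′)
  shuffle = solve-∀
  right : ∀ s a a′ b′ → a ℕ.* (s ℕ.* (a′ ℕ.+ b′)) ≡ s ℕ.* (a ℕ.* b′) ℕ.+ s ℕ.* (a ℕ.* a′)
  right = solve-∀

-- Pascal's rule on both sides produces the common term `b * b′`; what is left is `C-ratio-mono`.
C-log-concave-step : ∀ e {m m′} → m ℕ.≤ m′ →
                     (m C e) ℕ.* (suc m′ C e) ℕ.≤ (suc m C e) ℕ.* (m′ C e)
C-log-concave-step zero    m≤m′ = ℕ.≤-refl
C-log-concave-step (suc e) {m} {m′} m≤m′ = begin
  b ℕ.* (suc m′ C suc e)    ≡⟨ cong (b ℕ.*_) (sym (nCk+nC[k+1]≡[n+1]C[k+1] m′ e)) ⟩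
  b ℕ.* (a′ ℕ.+ b′)         ≡⟨ ℕ.*-distribˡ-+ b a′ b′ ⟩
  b ℕ.* a′ ℕ.+ b ℕ.* b′     ≤⟨ ℕ.+-monoˡ-≤ (b ℕ.* b′) (C-ratio-mono e m≤m′) ⟩
  a ℕ.* b′ ℕ.+ b ℕ.* b′     ≡⟨ sym (ℕ.*-distribʳ-+ b′ a b) ⟩
  (a ℕ.+ b) ℕ.* b′          ≡⟨ cong (ℕ._* b′) (nCk+nC[k+1]≡[n+1]C[k+1] m e) ⟩
  (suc m C suc e) ℕ.* b′    ∎
  where
  open ℕ.≤-Reasoning
  a  = m C e
  b  = m C suc e
  a′ = m′ C e
  b′ = m′ C suc e

-- The outer pair `m`, `m′ + suc r` moves inwards to `suc m`, `m′ + r`, while the target pair stays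
-- fixed. The recursion stops at `r = 0`, or when `m` reaches `m′` and the two sides differ by
-- commutativity only.
C-log-concave : ∀ e {m m′} r → m ℕ.≤ m′ →
                (m C e) ℕ.* ((m′ ℕ.+ r) C e) ℕ.≤ ((m ℕ.+ r) C e) ℕ.* (m′ C e)
C-log-concave e {m} {m′} zero m≤m′
  rewrite ℕ.+-identityʳ m | ℕ.+-identityʳ m′ = ℕ.≤-refl
C-log-concave e {m} {m′} (suc r) m≤m′ with ℕ.m≤n⇒m<n∨m≡n m≤m′
... | inj₂ refl = ℕ.≤-reflexive (ℕ.*-comm (m C e) _)
... | inj₁ m<m′ rewrite ℕ.+-suc m r | ℕ.+-suc m′ r =
  ℕ.≤-trans (C-log-concave-step e (ℕ.≤-trans m≤m′ (ℕ.m≤m+n m′ r)))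
            (C-log-concave e r m<m′)

-- The case of a pair symmetric about `c`. If `r` exceeds `c`, the truncated difference is 0, and
-- either `0 C e` vanishes or `e = 0` and both sides are 1.
C-log-concave-∸ : ∀ e c r → ((c ℕ.∸ r) C e) ℕ.* ((c ℕ.+ r) C e) ℕ.≤ (c C e) ℕ.* (c C e)
C-log-concave-∸ e c r with ℕ.≤-total r c
... | inj₁ r≤c = subst (λ z → ((c ℕ.∸ r) C e) ℕ.* ((c ℕ.+ r) C e) ℕ.≤ (z C e) ℕ.* (c C e))
                   (ℕ.m∸n+n≡m r≤c) (C-log-concave e r (ℕ.m∸n≤m c r))
... | inj₂ c≤r rewrite ℕ.m≤n⇒m∸n≡0 c≤r = degenerate e
  where
  degenerate : ∀ e → (0 C e) ℕ.* ((c ℕ.+ r) C e) ℕ.≤ (c C e) ℕ.* (c C e)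
  degenerate zero    = ℕ.≤-refl
  degenerate (suc e) = ℕ.z≤n

nCk>0 : ∀ {m e} → e ℕ.≤ m → 0 ℕ.< m C e
nCk>0 {m}     {zero}  _         = ℕ.≤-refl
nCk>0 {suc m} {suc e} (ℕ.s≤s e≤m) =
  subst (0 ℕ.<_) (nCk+nC[k+1]≡[n+1]C[k+1] m e) (ℕ.≤-trans (nCk>0 e≤m) (ℕ.m≤m+n _ _))

-- Counting supersets and subsets

∑-subsets-suc : ∀ n (f : Subset (suc n) → ℕ) →
                ∑ (subsets (suc n)) f
                ≡ ∑ (subsets n) (f ∘ (inside ∷_)) ℕ.+ ∑ (subsets n) (f ∘ (outside ∷_))
∑-subsets-suc n f =
  trans (∑-++ (map (inside ∷_) (subsets n)))
        (cong₂ ℕ._+_ (∑-map _ (subsets n)) (∑-map _ (subsets n)))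

∈-subsets : (J : Subset n) → J ∈ˡ subsets n
∈-subsets []            = here refl
∈-subsets (inside ∷ J)  = ∈-++⁺ˡ (∈-map⁺ (inside ∷_) (∈-subsets J))
∈-subsets (outside ∷ J) = ∈-++⁺ʳ _ (∈-map⁺ (outside ∷_) (∈-subsets J))

in⊈out : {p q : Subset n} → ¬ (inside ∷ p ⊆ outside ∷ q)
in⊈out sub with () ← sub Data.Vec.here

-- S is counted by its co-size, which makes the formula valid without ∣ J ∣ ≤ ∣ S ∣.
count-supersets : ∀ (J : Subset n) e →
                  ∑ (subsets n) (λ S → ⟦ ∣ ∁ S ∣ ℕ.≟ e ⟧ ℕ.* ⟦ J ⊆? S ⟧) ≡ ∣ ∁ J ∣ C e
count-supersets {zero} [] zero    = refl
count-supersets {zero} [] (suc e) = refl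
count-supersets {suc n} (inside ∷ J) e = begin
  _ ≡⟨ ∑-subsets-suc n _ ⟩
  _ ≡⟨ cong₂ ℕ._+_
         (∑-cong (subsets n) (λ S →
           cong (⟦ ∣ ∁ S ∣ ℕ.≟ e ⟧ ℕ.*_)
             (⟦⟧-⇔ (inside ∷ J ⊆? inside ∷ S) (J ⊆? S) (mk⇔ drop-∷-⊆ in⊆in))))
         (trans (∑-cong (subsets n) (λ S →
                  trans (cong (⟦ suc ∣ ∁ S ∣ ℕ.≟ e ⟧ ℕ.*_)
                          (⟦⟧-no (inside ∷ J ⊆? outside ∷ S) in⊈out))
                        (ℕ.*-zeroʳ ⟦ suc ∣ ∁ S ∣ ℕ.≟ e ⟧)))
                (∑-zero (subsets n))) ⟩
  _ ≡⟨ ℕ.+-identityʳ _ ⟩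
  _ ≡⟨ count-supersets J e ⟩
  ∣ ∁ J ∣ C e ∎
  where open ≡-Reasoning
count-supersets {suc n} (outside ∷ J) e = begin
  _ ≡⟨ ∑-subsets-suc n _ ⟩
  _ ≡⟨ cong₂ ℕ._+_
         (∑-cong (subsets n) (λ S → cong (⟦ ∣ ∁ S ∣ ℕ.≟ e ⟧ ℕ.*_) (drop-out inside S)))
         (∑-cong (subsets n) (λ S → cong (⟦ suc ∣ ∁ S ∣ ℕ.≟ e ⟧ ℕ.*_) (drop-out outside S))) ⟩
  _ ≡⟨ cong (ℕ._+ ∑ (subsets n) (λ S → ⟦ suc ∣ ∁ S ∣ ℕ.≟ e ⟧ ℕ.* ⟦ J ⊆? S ⟧))
         (count-supersets J e) ⟩
  _ ≡⟨ pascal e ⟩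
  suc ∣ ∁ J ∣ C e ∎
  where
  open ≡-Reasoning
  drop-out : ∀ s S → ⟦ outside ∷ J ⊆? s ∷ S ⟧ ≡ ⟦ J ⊆? S ⟧
  drop-out s S = ⟦⟧-⇔ (outside ∷ J ⊆? s ∷ S) (J ⊆? S) (mk⇔ drop-∷-⊆ out⊆)
  pascal : ∀ e → ∣ ∁ J ∣ C e ℕ.+
                 ∑ (subsets n) (λ S → ⟦ suc ∣ ∁ S ∣ ℕ.≟ e ⟧ ℕ.* ⟦ J ⊆? S ⟧)
                 ≡ suc ∣ ∁ J ∣ C e
  -- A set omitting the new point has that point in its complement, so the rest has co-size one
  -- smaller: no such set exists for co-size 0.
  pascal zero    = cong (1 ℕ.+_) (∑-zero (subsets n))
  pascal (suc e) = begin
    _ ≡⟨ cong (∣ ∁ J ∣ C suc e ℕ.+_) (∑-cong (subsets n) (λ S →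
           cong (ℕ._* ⟦ J ⊆? S ⟧)
             (⟦⟧-⇔ (suc ∣ ∁ S ∣ ℕ.≟ suc e) (∣ ∁ S ∣ ℕ.≟ e) (mk⇔ ℕ.suc-injective (cong suc))))) ⟩
    _ ≡⟨ cong (∣ ∁ J ∣ C suc e ℕ.+_) (count-supersets J e) ⟩
    _ ≡⟨ ℕ.+-comm (∣ ∁ J ∣ C suc e) _ ⟩
    _ ≡⟨ nCk+nC[k+1]≡[n+1]C[k+1] ∣ ∁ J ∣ e ⟩
    _ ∎

-- A `k`-set containing `J` amounts to its complement, an `(n ∸ k)`-subset of `∁ J`. This is the
-- closed form of `N(J)`.
count-kSupersets : ∀ {n k} → k ℕ.≤ n → (J : Subset n) →
                   ∑ (kSubsets n k) (λ S → ⟦ J ⊆? S ⟧) ≡ ∣ ∁ J ∣ C (n ℕ.∸ k)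
count-kSupersets {n} {k} k≤n J = begin
  _ ≡⟨ ∑-filter (λ S → ∣ S ∣ ℕ.≟ k) (subsets n) _ ⟩
  _ ≡⟨ ∑-cong (subsets n) (λ S → cong (ℕ._* ⟦ J ⊆? S ⟧) (co-size S)) ⟩
  _ ≡⟨ count-supersets J (n ℕ.∸ k) ⟩
  _ ∎
  where
  open ≡-Reasoning
  co-size : ∀ S → ⟦ ∣ S ∣ ℕ.≟ k ⟧ ≡ ⟦ ∣ ∁ S ∣ ℕ.≟ n ℕ.∸ k ⟧
  co-size S = ⟦⟧-⇔ (∣ S ∣ ℕ.≟ k) (∣ ∁ S ∣ ℕ.≟ n ℕ.∸ k) (mk⇔
    (λ S≡k → trans (∣∁p∣≡n∸∣p∣ S) (cong (n ℕ.∸_) S≡k))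
    (λ ∁S≡ → ℕ.∸-cancelˡ-≡ (∣p∣≤n S) k≤n (trans (sym (∣∁p∣≡n∸∣p∣ S)) ∁S≡)))

count-subsets : (I : Subset n) → ∑ (subsets n) (λ J → ⟦ J ⊆? I ⟧) ≡ 2 ^ ∣ I ∣
count-subsets {zero}  [] = refl
count-subsets {suc n} (inside ∷ I) = begin
  _ ≡⟨ ∑-subsets-suc n _ ⟩
  _ ≡⟨ cong₂ ℕ._+_
         (∑-cong (subsets n) (λ J →
           ⟦⟧-⇔ (inside ∷ J ⊆? inside ∷ I) (J ⊆? I) (mk⇔ drop-∷-⊆ in⊆in)))
         (∑-cong (subsets n) (λ J →
           ⟦⟧-⇔ (outside ∷ J ⊆? inside ∷ I) (J ⊆? I) (mk⇔ drop-∷-⊆ out⊆))) ⟩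
  _ ≡⟨ cong₂ ℕ._+_ (count-subsets I) (trans (count-subsets I) (sym (ℕ.+-identityʳ _))) ⟩
  _ ∎
  where open ≡-Reasoning
count-subsets {suc n} (outside ∷ I) = begin
  _ ≡⟨ ∑-subsets-suc n _ ⟩
  _ ≡⟨ cong₂ ℕ._+_
         (trans (∑-cong (subsets n) (λ J → ⟦⟧-no (inside ∷ J ⊆? outside ∷ I) in⊈out))
                (∑-zero (subsets n)))
         (∑-cong (subsets n) (λ J →
           ⟦⟧-⇔ (outside ∷ J ⊆? outside ∷ I) (J ⊆? I) (mk⇔ drop-∷-⊆ out⊆))) ⟩
  _ ≡⟨ count-subsets I ⟩
  _ ∎
  where open ≡-Reasoning

∣∁∣-modular : (p q : Subset n) → ∣ ∁ (p ∪ q) ∣ ℕ.+ ∣ ∁ (p ∩ q) ∣ ≡ ∣ ∁ p ∣ ℕ.+ ∣ ∁ q ∣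
∣∁∣-modular [] [] = refl
∣∁∣-modular (inside ∷ p)  (inside ∷ q)  = ∣∁∣-modular p q
∣∁∣-modular (inside ∷ p)  (outside ∷ q) =
  trans (ℕ.+-suc _ _) (trans (cong suc (∣∁∣-modular p q)) (sym (ℕ.+-suc _ _)))
∣∁∣-modular (outside ∷ p) (inside ∷ q)  = trans (ℕ.+-suc _ _) (cong suc (∣∁∣-modular p q))
∣∁∣-modular (outside ∷ p) (outside ∷ q) =
  cong suc (trans (ℕ.+-suc _ _) (trans (cong suc (∣∁∣-modular p q)) (sym (ℕ.+-suc _ _))))

-- Saturated multisets of edges

load : List (Subset n) → Subset n → ℕ
load ws J = ∑ ws (λ I → ⟦ J ⊆? I ⟧)

load-replicate-++ : ∀ w (I : Subset n) ws J →
                    load (replicate w I ++ ws) J ≡ w ℕ.* ⟦ J ⊆? I ⟧ ℕ.+ load ws J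
load-replicate-++ w I ws J =
  trans (∑-++ (replicate w I)) (cong (ℕ._+ load ws J) (∑-replicate w))

-- The edges are treated one at a time, each `I` being added as often as the least slack among the
-- subsets of `I` allows. Only loads of subsets of `I` change, so no cap is exceeded; the minimiser
-- becomes tight, and earlier tight sets stay tight because loads never decrease.
saturate : ∀ (cap : Subset n → ℕ) {P : Pred (Subset n) 0ℓ} {xs} → All P xs →
           ∃[ ws ] All P ws × (∀ J → load ws J ℕ.≤ cap J) ×
                   All (λ I → ∃[ J ] J ⊆ I × cap J ℕ.≤ load ws J) xs
saturate cap [] = [] , [] , (λ _ → ℕ.z≤n) , []
saturate {n} cap {xs = I ∷ _} (pI ∷ pxs) =
  replicate w I ++ ws , All.++⁺ (All.replicate⁺ w pI) pws , bounded ,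
  (J₀ , J₀⊆I , J₀-tight) ∷
  All.map stays-tight tights
  where
  rest   = saturate cap pxs
  ws     = proj₁ rest
  pws    = proj₁ (proj₂ rest)
  fits   = proj₁ (proj₂ (proj₂ rest))
  tights = proj₂ (proj₂ (proj₂ rest))

  slack : Subset n → ℕ
  slack J = cap J ℕ.∸ load ws J

  below-I = filter (_⊆? I) (subsets n)
  -- The default value `I` is a subset of itself, so the minimiser lies below `I` in every case.
  J₀ = argmin slack I below-I
  w  = slack J₀

  J₀⊆I : J₀ ⊆ I
  J₀⊆I = argmin-all slack {P = _⊆ I} (λ x∈I → x∈I) (All.all-filter (_⊆? I) (subsets n))

  w≤slack : ∀ {J} → J ⊆ I → w ℕ.≤ slack J
  w≤slack {J} J⊆I =
    All.lookup (f[argmin]≤f[xs] I below-I) (∈-filter⁺ (_⊆? I) (∈-subsets J) J⊆I)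

  load-grows : ∀ J → load ws J ℕ.≤ load (replicate w I ++ ws) J
  load-grows J rewrite load-replicate-++ w I ws J = ℕ.m≤n+m _ _

  stays-tight : ∀ {I′} → ∃[ J ] J ⊆ I′ × cap J ℕ.≤ load ws J →
                ∃[ J ] J ⊆ I′ × cap J ℕ.≤ load (replicate w I ++ ws) J
  stays-tight (J , J⊆I′ , tight) = J , J⊆I′ , ℕ.≤-trans tight (load-grows J)

  bounded : ∀ J → load (replicate w I ++ ws) J ℕ.≤ cap J
  bounded J rewrite load-replicate-++ w I ws J with J ⊆? I
  ... | yes J⊆I rewrite ℕ.*-identityʳ w =
    ℕ.≤-trans (ℕ.+-monoˡ-≤ (load ws J) (w≤slack J⊆I)) (ℕ.≤-reflexive (ℕ.m∸n+n≡m (fits J)))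
  ... | no _ rewrite ℕ.*-zeroʳ w = fits J

  J₀-tight : cap J₀ ℕ.≤ load (replicate w I ++ ws) J₀
  J₀-tight rewrite load-replicate-++ w I ws J₀ | ⟦⟧-yes (J₀ ⊆? I) J₀⊆I | ℕ.*-identityʳ w =
    ℕ.≤-reflexive (sym (ℕ.m∸n+n≡m (fits J₀)))

-- The two moments

-- Double counting: each edge in `ws` contributes 1 to the load of each of its `2 ^ d` subsets.
∑-load : ∀ {d} {ws : List (Subset n)} → All (λ I → ∣ I ∣ ≡ d) ws →
         ∑ (subsets n) (load ws) ≡ length ws ℕ.* 2 ^ d
∑-load {n} {d} {ws} sizes = begin
  _ ≡⟨ ∑-swap (subsets n) ws _ ⟩
  _ ≡⟨ ∑-cong ws count-subsets ⟩
  _ ≡⟨ ∑-cong-All sizes ⟩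
  _ ≡⟨ ∑-const ws (2 ^ d) ⟩
  _ ∎
  where
  open ≡-Reasoning
  ∑-cong-All : ∀ {ws} → All (λ I → ∣ I ∣ ≡ d) ws →
               ∑ ws (λ I → 2 ^ ∣ I ∣) ≡ ∑ ws (λ _ → 2 ^ d)
  ∑-cong-All []           = refl
  ∑-cong-All (refl ∷ pws) = cong (2 ^ d ℕ.+_) (∑-cong-All pws)

-- Union bound: a hit set contains an edge from `xs`, hence a tight `J`, so its indicator is at most
-- the number of tight sets inside it.
hits-bound : ∀ (L ws xs : List (Subset n)) {H : Pred (Subset n) 0ℓ} (H? : Decidable H) →
             All (λ I → ∃[ J ] J ⊆ I × ∑ L (λ S → ⟦ J ⊆? S ⟧) ℕ.≤ load ws J) xs →
             (∀ {S} → H S → ∃[ I ] I ∈ˡ xs × I ⊆ S) →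
             ∑ L (λ S → ⟦ H? S ⟧) ℕ.≤ ∑ (subsets n) (load ws)
hits-bound {n} L ws xs {H} H? tights hit = begin
  ∑ L (λ S → ⟦ H? S ⟧)
    ≤⟨ ∑-mono L pointwise ⟩
  ∑ L (λ S → ∑ (subsets n) (λ J → ⟦ tight? J ⟧ ℕ.* ⟦ J ⊆? S ⟧))
    ≡⟨ ∑-swap L (subsets n) _ ⟩
  ∑ (subsets n) (λ J → ∑ L (λ S → ⟦ tight? J ⟧ ℕ.* ⟦ J ⊆? S ⟧))
    ≡⟨ ∑-cong (subsets n) (λ J → ∑-*ˡ ⟦ tight? J ⟧ L _) ⟩
  ∑ (subsets n) (λ J → ⟦ tight? J ⟧ ℕ.* ∑ L (λ S → ⟦ J ⊆? S ⟧))
    -- Tightness of `J` is the very inequality needed; the other `J` contribute 0.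
    ≤⟨ ∑-mono (subsets n) (λ J → ⟦⟧-*-≤ (tight? J) (λ tight → tight)) ⟩
  ∑ (subsets n) (load ws) ∎
  where
  open ℕ.≤-Reasoning
  tight? : ∀ J → Dec (∑ L (λ S → ⟦ J ⊆? S ⟧) ℕ.≤ load ws J)
  tight? J = ∑ L (λ S → ⟦ J ⊆? S ⟧) ℕ.≤? load ws J

  pointwise : ∀ S → ⟦ H? S ⟧ ℕ.≤ ∑ (subsets n) (λ J → ⟦ tight? J ⟧ ℕ.* ⟦ J ⊆? S ⟧)
  pointwise S with H? S
  ... | no _  = ℕ.z≤n
  ... | yes h =
    let I , I∈xs , I⊆S    = hit h
        J , J⊆I , tight   = All.lookup tights I∈xs
    in ℕ.≤-trans
         (ℕ.≤-reflexive (sym (cong₂ ℕ._*_ (⟦⟧-yes (tight? J) tight)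
                                           (⟦⟧-yes (J ⊆? S) (⊆-trans J⊆I I⊆S)))))
         (≤-∑ (λ J → ⟦ tight? J ⟧ ℕ.* ⟦ J ⊆? S ⟧) (∈-subsets J))

-- The density hypothesis is summed over `ws` with multiplicity, and the sums are exchanged. The
-- weight `y` will be the indicator of `Y`.
first-moment : ∀ (L ws : List (Subset n)) (y : Subset n → ℕ) a D →
               All (λ I → D ℕ.≤ a ℕ.* ∑ L (λ S → y S ℕ.* ⟦ I ⊆? S ⟧)) ws →
               length ws ℕ.* D ℕ.≤ a ℕ.* ∑ L (λ S → y S ℕ.* ∑ ws (λ I → ⟦ I ⊆? S ⟧))
first-moment L ws y a D dense = begin
  length ws ℕ.* D
    ≡⟨ sym (∑-const ws D) ⟩
  ∑ ws (λ _ → D)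
    ≤⟨ ∑-mono-All dense ⟩
  ∑ ws (λ I → a ℕ.* ∑ L (λ S → y S ℕ.* ⟦ I ⊆? S ⟧))
    ≡⟨ ∑-*ˡ a ws _ ⟩
  a ℕ.* ∑ ws (λ I → ∑ L (λ S → y S ℕ.* ⟦ I ⊆? S ⟧))
    ≡⟨ cong (a ℕ.*_) (∑-swap ws L _) ⟩
  a ℕ.* ∑ L (λ S → ∑ ws (λ I → y S ℕ.* ⟦ I ⊆? S ⟧))
    ≡⟨ cong (a ℕ.*_) (∑-cong L (λ S → ∑-*ˡ (y S) ws _)) ⟩
  a ℕ.* ∑ L (λ S → y S ℕ.* ∑ ws (λ I → ⟦ I ⊆? S ⟧)) ∎
  where open ℕ.≤-Reasoning

⟦⊆⟧-∪ : (p q S : Subset n) → ⟦ p ⊆? S ⟧ ℕ.* ⟦ q ⊆? S ⟧ ≡ ⟦ p ∪ q ⊆? S ⟧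
⟦⊆⟧-∪ p q S with p ⊆? S | q ⊆? S
... | yes p⊆S | yes q⊆S =
  sym (⟦⟧-yes (p ∪ q ⊆? S) (λ x∈p∪q → [ p⊆S , q⊆S ]′ (x∈p∪q⁻ p q x∈p∪q)))
... | yes _   | no q⊈S  = sym (⟦⟧-no (p ∪ q ⊆? S) (λ p∪q⊆S → q⊈S (p∪q⊆S ∘ q⊆p∪q p q)))
... | no p⊈S  | _       = sym (⟦⟧-no (p ∪ q ⊆? S) (λ p∪q⊆S → p⊈S (p∪q⊆S ∘ p⊆p∪q q)))

-- The size of `I ∪ I′` depends only on that of `J = I ∩ I′`. Relaxing `J = I ∩ I′` to `J ⊆ I` and
-- `J ⊆ I′` only enlarges the sum, and makes the number of `I′` for a given `J` equal to
-- `load ws J`. Each of the `2 ^ ∣ I ∣` sets `J` then contributes at most the square of `c C e`.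
∑-unions : ∀ {c} e {ws : List (Subset n)} → All (λ I → ∣ ∁ I ∣ ≡ c) ws →
           (∀ J → load ws J ℕ.≤ ∣ ∁ J ∣ C e) → ∀ I → ∣ ∁ I ∣ ≡ c →
           ∑ ws (λ I′ → ∣ ∁ (I ∪ I′) ∣ C e) ℕ.≤ 2 ^ ∣ I ∣ ℕ.* ((c C e) ℕ.* (c C e))
∑-unions {n} {c} e {ws} sizes fits I ∣∁I∣≡c = begin
  ∑ ws (λ I′ → ∣ ∁ (I ∪ I′) ∣ C e)
    ≤⟨ ∑-mono-All (All.map pointwise sizes) ⟩
  ∑ ws (λ I′ → ∑ (subsets n) (λ J → ⟦ J ⊆? I ⟧ ℕ.* g J ℕ.* ⟦ J ⊆? I′ ⟧))
    ≡⟨ ∑-swap ws (subsets n) _ ⟩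
  ∑ (subsets n) (λ J → ∑ ws (λ I′ → ⟦ J ⊆? I ⟧ ℕ.* g J ℕ.* ⟦ J ⊆? I′ ⟧))
    ≡⟨ ∑-cong (subsets n) (λ J → ∑-*ˡ (⟦ J ⊆? I ⟧ ℕ.* g J) ws _) ⟩
  ∑ (subsets n) (λ J → ⟦ J ⊆? I ⟧ ℕ.* g J ℕ.* load ws J)
    ≤⟨ ∑-mono (subsets n) balanced ⟩
  ∑ (subsets n) (λ J → ⟦ J ⊆? I ⟧ ℕ.* ((c C e) ℕ.* (c C e)))
    ≡⟨ ∑-*ʳ (subsets n) _ _ ⟩
  ∑ (subsets n) (λ J → ⟦ J ⊆? I ⟧) ℕ.* ((c C e) ℕ.* (c C e))
    ≡⟨ cong (ℕ._* ((c C e) ℕ.* (c C e))) (count-subsets I) ⟩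
  2 ^ ∣ I ∣ ℕ.* ((c C e) ℕ.* (c C e)) ∎
  where
  open ℕ.≤-Reasoning
  -- The value of `N(I ∪ I′)` when `J` is the intersection: the co-size of the union is
  -- `2c - ∣ ∁ J ∣`, written as `c` minus the excess of `∣ ∁ J ∣` over `c` to fit `C-log-concave-∸`.
  g : Subset n → ℕ
  g J = (c ℕ.∸ (∣ ∁ J ∣ ℕ.∸ c)) C e

  c≤∣∁_∣ : ∀ J → J ⊆ I → c ℕ.≤ ∣ ∁ J ∣
  c≤∣∁ J ∣ J⊆I = subst (ℕ._≤ ∣ ∁ J ∣) ∣∁I∣≡c (p⊆q⇒∣p∣≤∣q∣ (p⊆q⇒∁p⊇∁q J⊆I))

  balanced : ∀ J → ⟦ J ⊆? I ⟧ ℕ.* g J ℕ.* load ws J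
                   ℕ.≤ ⟦ J ⊆? I ⟧ ℕ.* ((c C e) ℕ.* (c C e))
  balanced J with J ⊆? I
  ... | no _    = ℕ.z≤n
  ... | yes J⊆I = begin
    1 ℕ.* g J ℕ.* load ws J
      ≡⟨ ℕ.*-assoc 1 (g J) _ ⟩
    1 ℕ.* (g J ℕ.* load ws J)
      ≤⟨ ℕ.*-monoʳ-≤ 1 (ℕ.*-monoʳ-≤ (g J) (fits J)) ⟩
    1 ℕ.* (g J ℕ.* (∣ ∁ J ∣ C e))
      -- Since `J ⊆ I`, its co-size is at least `c`; the upper arguments of `g J` and of the cap are
      -- now symmetric about `c`.
      ≡⟨ cong (λ m → 1 ℕ.* (g J ℕ.* (m C e))) (sym (ℕ.m+[n∸m]≡n (c≤∣∁ J ∣ J⊆I))) ⟩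
    1 ℕ.* (g J ℕ.* ((c ℕ.+ (∣ ∁ J ∣ ℕ.∸ c)) C e))
      ≤⟨ ℕ.*-monoʳ-≤ 1 (C-log-concave-∸ e c (∣ ∁ J ∣ ℕ.∸ c)) ⟩
    1 ℕ.* ((c C e) ℕ.* (c C e)) ∎

  ∣∁∪∣ : ∀ I′ → ∣ ∁ I′ ∣ ≡ c → ∣ ∁ (I ∪ I′) ∣ ≡ c ℕ.∸ (∣ ∁ (I ∩ I′) ∣ ℕ.∸ c)
  ∣∁∪∣ I′ ∣∁I′∣≡c = sym (begin-equality
    c ℕ.∸ (j ℕ.∸ c)                     ≡⟨ sym (ℕ.[m+n]∸[m+o]≡n∸o c c _) ⟩
    (c ℕ.+ c) ℕ.∸ (c ℕ.+ (j ℕ.∸ c))     ≡⟨ cong ((c ℕ.+ c) ℕ.∸_)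
                                             (ℕ.m+[n∸m]≡n (c≤∣∁ I ∩ I′ ∣ (p∩q⊆p I I′))) ⟩
    (c ℕ.+ c) ℕ.∸ j                     ≡⟨ cong (ℕ._∸ j) (sym (trans (∣∁∣-modular I I′)
                                             (cong₂ ℕ._+_ ∣∁I∣≡c ∣∁I′∣≡c))) ⟩
    (∣ ∁ (I ∪ I′) ∣ ℕ.+ j) ℕ.∸ j        ≡⟨ ℕ.m+n∸n≡m _ j ⟩
    ∣ ∁ (I ∪ I′) ∣                      ∎)
    where j = ∣ ∁ (I ∩ I′) ∣

  pointwise : ∀ {I′} → ∣ ∁ I′ ∣ ≡ c →
              ∣ ∁ (I ∪ I′) ∣ C e
              ℕ.≤ ∑ (subsets n) (λ J → ⟦ J ⊆? I ⟧ ℕ.* g J ℕ.* ⟦ J ⊆? I′ ⟧)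
  pointwise {I′} ∣∁I′∣≡c = begin
    ∣ ∁ (I ∪ I′) ∣ C e
      ≡⟨ cong (_C e) (∣∁∪∣ I′ ∣∁I′∣≡c) ⟩
    g (I ∩ I′)
      ≡⟨ sym (trans (ℕ.*-identityʳ _) (ℕ.*-identityˡ _)) ⟩
    1 ℕ.* g (I ∩ I′) ℕ.* 1
      ≡⟨ sym (cong₂ (λ u v → u ℕ.* g (I ∩ I′) ℕ.* v)
           (⟦⟧-yes (I ∩ I′ ⊆? I) (p∩q⊆p I I′)) (⟦⟧-yes (I ∩ I′ ⊆? I′) (p∩q⊆q I I′))) ⟩
    ⟦ I ∩ I′ ⊆? I ⟧ ℕ.* g (I ∩ I′) ℕ.* ⟦ I ∩ I′ ⊆? I′ ⟧
      -- The single term at `J = I ∩ I′` is enough.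
      ≤⟨ ≤-∑ (λ J → ⟦ J ⊆? I ⟧ ℕ.* g J ℕ.* ⟦ J ⊆? I′ ⟧) (∈-subsets (I ∩ I′)) ⟩
    ∑ (subsets n) (λ J → ⟦ J ⊆? I ⟧ ℕ.* g J ℕ.* ⟦ J ⊆? I′ ⟧) ∎

-- The square `f S * f S` counts ordered pairs of edges whose union lies in `S`. Summing over `S`
-- first turns each pair into `N(I ∪ I′)`, and `∑-unions` bounds the sum over `I′` for each fixed
-- `I`.
second-moment : ∀ {k d} → k ℕ.≤ n → {ws : List (Subset n)} → All (λ I → ∣ I ∣ ≡ d) ws →
                (∀ J → load ws J ℕ.≤ ∣ ∁ J ∣ C (n ℕ.∸ k)) →
                let D = (n ℕ.∸ d) C (n ℕ.∸ k)
                    f = λ S → ∑ ws (λ I → ⟦ I ⊆? S ⟧)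
                in ∑ (kSubsets n k) (λ S → f S ℕ.* f S) ℕ.≤ length ws ℕ.* (2 ^ d ℕ.* (D ℕ.* D))
second-moment {n} {k} {d} k≤n {ws} sizes fits = begin
  ∑ L (λ S → ∑ ws (λ I → ⟦ I ⊆? S ⟧) ℕ.* ∑ ws (λ I → ⟦ I ⊆? S ⟧))
    ≡⟨ ∑-cong L (λ S → trans (∑-* ws ws _ _)
         (∑-cong ws (λ I → ∑-cong ws (λ I′ → ⟦⊆⟧-∪ I I′ S)))) ⟩
  ∑ L (λ S → ∑ ws (λ I → ∑ ws (λ I′ → ⟦ I ∪ I′ ⊆? S ⟧)))
    ≡⟨ ∑-swap L ws _ ⟩
  ∑ ws (λ I → ∑ L (λ S → ∑ ws (λ I′ → ⟦ I ∪ I′ ⊆? S ⟧)))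
    ≡⟨ ∑-cong ws (λ I → trans (∑-swap L ws _)
         (∑-cong ws (λ I′ → count-kSupersets k≤n (I ∪ I′)))) ⟩
  ∑ ws (λ I → ∑ ws (λ I′ → ∣ ∁ (I ∪ I′) ∣ C e))
    ≤⟨ ∑-mono-All (All.map (λ {I} ∣I∣≡d →
         subst (λ m → ∑ ws (λ I′ → ∣ ∁ (I ∪ I′) ∣ C e) ℕ.≤ 2 ^ m ℕ.* (D ℕ.* D)) ∣I∣≡d
           (∑-unions e (All.map (λ {I′} → co-size I′) sizes) fits I (co-size I ∣I∣≡d))) sizes) ⟩
  ∑ ws (λ _ → 2 ^ d ℕ.* (D ℕ.* D))
    ≡⟨ ∑-const ws _ ⟩
  length ws ℕ.* (2 ^ d ℕ.* (D ℕ.* D)) ∎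
  where
  open ℕ.≤-Reasoning
  L = kSubsets n k
  e = n ℕ.∸ k
  D = (n ℕ.∸ d) C e
  co-size : ∀ I → ∣ I ∣ ≡ d → ∣ ∁ I ∣ ≡ n ℕ.∸ d
  co-size I ∣I∣≡d = trans (∣∁p∣≡n∸∣p∣ I) (cong (n ℕ.∸_) ∣I∣≡d)

-- Cauchy-Schwarz and the counting inequality

2mn≤m²+n² : ∀ m n → 2 ℕ.* (m ℕ.* n) ℕ.≤ m ℕ.* m ℕ.+ n ℕ.* n
2mn≤m²+n² m n = [ ordered , (λ n≤m → swapped (ordered n≤m)) ]′ (ℕ.≤-total m n)
  where
  expand : ∀ m r → 2 ℕ.* (m ℕ.* (m ℕ.+ r)) ℕ.+ r ℕ.* r
                   ≡ m ℕ.* m ℕ.+ (m ℕ.+ r) ℕ.* (m ℕ.+ r)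
  expand = solve-∀
  ordered : ∀ {m n} → m ℕ.≤ n → 2 ℕ.* (m ℕ.* n) ℕ.≤ m ℕ.* m ℕ.+ n ℕ.* n
  ordered {m} m≤n with r , refl ← ℕ.m≤n⇒∃[o]m+o≡n m≤n =
    ℕ.≤-trans (ℕ.m≤m+n _ (r ℕ.* r)) (ℕ.≤-reflexive (expand m r))
  swapped : 2 ℕ.* (n ℕ.* m) ℕ.≤ n ℕ.* n ℕ.+ m ℕ.* m →
            2 ℕ.* (m ℕ.* n) ℕ.≤ m ℕ.* m ℕ.+ n ℕ.* n
  swapped rewrite ℕ.*-comm n m | ℕ.+-comm (n ℕ.* n) (m ℕ.* m) = λ p → p

-- Cauchy–Schwarz in the form 2tx ≤ x² + t²; t is chosen optimally in edges-bound.
tangent-bound : ∀ (L : List X) {Y : Pred X 0ℓ} (Y? : Decidable Y) (f : X → ℕ) t →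
                2 ℕ.* t ℕ.* ∑ L (λ S → ⟦ Y? S ⟧ ℕ.* f S)
                ℕ.≤ ∑ L (λ S → f S ℕ.* f S) ℕ.+ t ℕ.* t ℕ.* ∑ L (λ S → ⟦ Y? S ⟧)
tangent-bound L Y? f t = begin
  2 ℕ.* t ℕ.* ∑ L (λ S → ⟦ Y? S ⟧ ℕ.* f S)
    ≡⟨ sym (∑-*ˡ (2 ℕ.* t) L _) ⟩
  ∑ L (λ S → 2 ℕ.* t ℕ.* (⟦ Y? S ⟧ ℕ.* f S))
    ≤⟨ ∑-mono L pointwise ⟩
  ∑ L (λ S → f S ℕ.* f S ℕ.+ t ℕ.* t ℕ.* ⟦ Y? S ⟧)
    ≡⟨ ∑-+ L (λ S → f S ℕ.* f S) _ ⟩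
  ∑ L (λ S → f S ℕ.* f S) ℕ.+ ∑ L (λ S → t ℕ.* t ℕ.* ⟦ Y? S ⟧)
    ≡⟨ cong (∑ L (λ S → f S ℕ.* f S) ℕ.+_) (∑-*ˡ (t ℕ.* t) L _) ⟩
  ∑ L (λ S → f S ℕ.* f S) ℕ.+ t ℕ.* t ℕ.* ∑ L (λ S → ⟦ Y? S ⟧) ∎
  where
  open ℕ.≤-Reasoning
  left : ∀ t u → 2 ℕ.* t ℕ.* (1 ℕ.* u) ≡ 2 ℕ.* (u ℕ.* t)
  left = solve-∀
  pointwise : ∀ S → 2 ℕ.* t ℕ.* (⟦ Y? S ⟧ ℕ.* f S)
                    ℕ.≤ f S ℕ.* f S ℕ.+ t ℕ.* t ℕ.* ⟦ Y? S ⟧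
  pointwise S with Y? S
  ... | no _  = ℕ.≤-trans (ℕ.≤-reflexive (ℕ.*-zeroʳ (2 ℕ.* t))) ℕ.z≤n
  ... | yes _ = begin
    2 ℕ.* t ℕ.* (1 ℕ.* f S)          ≡⟨ left t (f S) ⟩
    2 ℕ.* (f S ℕ.* t)                ≤⟨ 2mn≤m²+n² (f S) t ⟩
    f S ℕ.* f S ℕ.+ t ℕ.* t          ≡⟨ cong (f S ℕ.* f S ℕ.+_) (sym (ℕ.*-identityʳ _)) ⟩
    f S ℕ.* f S ℕ.+ t ℕ.* t ℕ.* 1    ∎

-- The lower bound for the first moment and the upper bound for the second are both linear in
-- `length ws`. Adding the second-moment bound to both sides of the claim, scaled by `P * (D * D)`,
-- lets cancellation replace subtraction.
edges-bound : ∀ {k d} → d ℕ.≤ k → k ℕ.≤ n →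
              {ws : List (Subset n)} → All (λ I → ∣ I ∣ ≡ d) ws →
              (∀ J → load ws J ℕ.≤ ∣ ∁ J ∣ C (n ℕ.∸ k)) →
              ∀ {Y : Pred (Subset n) 0ℓ} (Y? : Decidable Y) a →
              All (λ I → (n ℕ.∸ d) C (n ℕ.∸ k) ℕ.≤
                         a ℕ.* ∑ (kSubsets n k) (λ S → ⟦ Y? S ⟧ ℕ.* ⟦ I ⊆? S ⟧)) ws →
              length ws ℕ.≤ a ℕ.* a ℕ.* 2 ^ d ℕ.* ∑ (kSubsets n k) (λ S → ⟦ Y? S ⟧)
edges-bound {n} {k} {d} d≤k k≤n {ws} sizes fits Y? a dense =
  ℕ.*-cancelʳ-≤ θ (a ℕ.* a ℕ.* P ℕ.* y) (P ℕ.* (D ℕ.* D)) {{nonZero}}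
    (ℕ.+-cancelˡ-≤ (θ ℕ.* (P ℕ.* (D ℕ.* D))) _ _ (begin
      θ ℕ.* (P ℕ.* (D ℕ.* D)) ℕ.+ θ ℕ.* (P ℕ.* (D ℕ.* D))
        ≡⟨ double θ P D ⟩
      2 ℕ.* (P ℕ.* D) ℕ.* (θ ℕ.* D)
        ≤⟨ ℕ.*-monoʳ-≤ (2 ℕ.* (P ℕ.* D)) (first-moment L ws (λ S → ⟦ Y? S ⟧) a D dense) ⟩
      2 ℕ.* (P ℕ.* D) ℕ.* (a ℕ.* x)
        ≡⟨ regroup P D a x ⟩
      2 ℕ.* t ℕ.* x
        ≤⟨ tangent-bound L Y? f t ⟩
      ∑ L (λ S → f S ℕ.* f S) ℕ.+ t ℕ.* t ℕ.* y
        ≤⟨ ℕ.+-monoˡ-≤ (t ℕ.* t ℕ.* y) (second-moment k≤n sizes fits) ⟩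
      θ ℕ.* (P ℕ.* (D ℕ.* D)) ℕ.+ t ℕ.* t ℕ.* y
        ≡⟨ cong (θ ℕ.* (P ℕ.* (D ℕ.* D)) ℕ.+_) (square a P D y) ⟩
      θ ℕ.* (P ℕ.* (D ℕ.* D)) ℕ.+ a ℕ.* a ℕ.* P ℕ.* y ℕ.* (P ℕ.* (D ℕ.* D)) ∎))
  where
  open ℕ.≤-Reasoning
  L = kSubsets n k
  D = (n ℕ.∸ d) C (n ℕ.∸ k)
  P = 2 ^ d
  θ = length ws
  y = ∑ L (λ S → ⟦ Y? S ⟧)
  f : Subset n → ℕ
  f S = ∑ ws (λ I → ⟦ I ⊆? S ⟧)
  x = ∑ L (λ S → ⟦ Y? S ⟧ ℕ.* f S)
  -- With this choice the first-moment term is at least twice the second-moment bound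
  -- `θ * (P * (D * D))`, so one copy survives against `t * t * y`.
  t = a ℕ.* P ℕ.* D

  nonZero : ℕ.NonZero (P ℕ.* (D ℕ.* D))
  nonZero = ℕ.m*n≢0 P (D ℕ.* D) {{ℕ.m^n≢0 2 d}} {{ℕ.m*n≢0 D D {{D≢0}} {{D≢0}}}}
    -- From `d ≤ k` follows `n ∸ k ≤ n ∸ d`, so `D` is positive and may be cancelled.
    where D≢0 = ℕ.>-nonZero (nCk>0 (ℕ.∸-monoʳ-≤ n d≤k))

  double : ∀ θ P D → θ ℕ.* (P ℕ.* (D ℕ.* D)) ℕ.+ θ ℕ.* (P ℕ.* (D ℕ.* D))
                     ≡ 2 ℕ.* (P ℕ.* D) ℕ.* (θ ℕ.* D)
  double = solve-∀
  regroup : ∀ P D a x → 2 ℕ.* (P ℕ.* D) ℕ.* (a ℕ.* x) ≡ 2 ℕ.* (a ℕ.* P ℕ.* D) ℕ.* x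
  regroup = solve-∀
  square : ∀ a P D y → a ℕ.* P ℕ.* D ℕ.* (a ℕ.* P ℕ.* D) ℕ.* y
                       ≡ a ℕ.* a ℕ.* P ℕ.* y ℕ.* (P ℕ.* (D ℕ.* D))
  square = solve-∀

-- One factor `2 ^ d` comes from the total load, the other from the second moment. Size and density
-- form the predicate that `saturate` carries over from `xs` to `ws`.
counting-bound : ∀ {n k d} → d ℕ.≤ k → k ℕ.≤ n → ∀ a
                 {Y H : Pred (Subset n) 0ℓ} (Y? : Decidable Y) (H? : Decidable H) {xs} →
                 (∀ {S} → H S → ∃[ I ] I ∈ˡ xs × I ⊆ S) →
                 All (λ I → ∣ I ∣ ≡ d × ∑ (kSubsets n k) (λ S → ⟦ I ⊆? S ⟧) ℕ.≤
                       a ℕ.* ∑ (kSubsets n k) (λ S → ⟦ Y? S ⟧ ℕ.* ⟦ I ⊆? S ⟧)) xs →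
                 ∑ (kSubsets n k) (λ S → ⟦ H? S ⟧)
                 ℕ.≤ a ℕ.* a ℕ.* 2 ^ d ℕ.* 2 ^ d ℕ.* ∑ (kSubsets n k) (λ S → ⟦ Y? S ⟧)
counting-bound {n} {k} {d} d≤k k≤n a Y? H? {xs} hit dense = begin
  ∑ L (λ S → ⟦ H? S ⟧)
    ≤⟨ hits-bound L ws xs H? tights hit ⟩
  ∑ (subsets n) (load ws)
    ≡⟨ ∑-load sizes ⟩
  length ws ℕ.* 2 ^ d
    ≤⟨ ℕ.*-monoˡ-≤ (2 ^ d) (edges-bound d≤k k≤n sizes
         (λ J → subst (load ws J ℕ.≤_) (count-kSupersets k≤n J) (fits J)) Y? a
         (All.map (λ {I} (∣I∣≡d , dense-I) → subst (ℕ._≤ _)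
           (trans (count-kSupersets k≤n I)
                  (cong (_C (n ℕ.∸ k)) (trans (∣∁p∣≡n∸∣p∣ I) (cong (n ℕ.∸_) ∣I∣≡d))))
           dense-I) pws)) ⟩
  a ℕ.* a ℕ.* 2 ^ d ℕ.* y ℕ.* 2 ^ d
    ≡⟨ rotate (a ℕ.* a ℕ.* 2 ^ d) y (2 ^ d) ⟩
  a ℕ.* a ℕ.* 2 ^ d ℕ.* 2 ^ d ℕ.* y ∎
  where
  open ℕ.≤-Reasoning
  L = kSubsets n k
  y = ∑ L (λ S → ⟦ Y? S ⟧)
  saturated = saturate (λ J → ∑ L (λ S → ⟦ J ⊆? S ⟧)) dense
  ws     = proj₁ saturated
  pws    = proj₁ (proj₂ saturated)
  fits   = proj₁ (proj₂ (proj₂ saturated))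
  tights = proj₂ (proj₂ (proj₂ saturated))
  sizes  = All.map proj₁ pws
  rotate : ∀ u v w → u ℕ.* v ℕ.* w ≡ u ℕ.* w ℕ.* v
  rotate = solve-∀

-- Rational arithmetic

toℚᵘ-fromℕ : ∀ m → toℚᵘ (fromℕ m) ℚᵘ.≃ ℚᵘ.mkℚᵘ (ℤ.+ m) 0
toℚᵘ-fromℕ m = ℚ.toℚᵘ-fromℚᵘ (ℚᵘ.mkℚᵘ (ℤ.+ m) 0)

fromℕ-mono-≤ : ∀ m o → m ℕ.≤ o → fromℕ m ≤ fromℕ o
fromℕ-mono-≤ m o m≤o = ℚ.toℚᵘ-cancel-≤
  (ℚᵘ.≤-respˡ-≃ (ℚᵘ.≃-sym (toℚᵘ-fromℕ m)) (ℚᵘ.≤-respʳ-≃ (ℚᵘ.≃-sym (toℚᵘ-fromℕ o))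
    (ℚᵘ.*≤* (ℤ.*-monoʳ-≤-nonNeg (ℤ.+ 1) (ℤ.+≤+ m≤o)))))

fromℕ-cancel-≤ : ∀ m o → fromℕ m ≤ fromℕ o → m ℕ.≤ o
fromℕ-cancel-≤ m o m≤o = ℤ.drop‿+≤+ (ℤ.*-cancelʳ-≤-pos _ _ (ℤ.+ 1) (ℚᵘ.drop-*≤*
  (ℚᵘ.≤-respˡ-≃ (toℚᵘ-fromℕ m) (ℚᵘ.≤-respʳ-≃ (toℚᵘ-fromℕ o) (ℚ.toℚᵘ-mono-≤ m≤o)))))

fromℕ-* : ∀ m o → fromℕ (m ℕ.* o) ≡ fromℕ m * fromℕ o
fromℕ-* m o = ℚ.toℚᵘ-injective (ℚᵘ.≃-trans (toℚᵘ-fromℕ (m ℕ.* o))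
  (ℚᵘ.≃-trans (ℚᵘ.*≡* (cong (ℤ._* ℤ.+ 1) (ℤ.pos-* m o)))
    (ℚᵘ.≃-sym (ℚᵘ.≃-trans (ℚ.toℚᵘ-homo-* (fromℕ m) (fromℕ o))
      (ℚᵘ.*-cong (toℚᵘ-fromℕ m) (toℚᵘ-fromℕ o))))))

0≤fromℕ : ∀ m → 0ℚ ≤ fromℕ m
0≤fromℕ m = fromℕ-mono-≤ 0 m ℕ.z≤n

archimedean : ∀ {q} → 0ℚ < q → ∃[ a ] 1ℚ ≤ fromℕ a * q
archimedean {mkℚ (ℤ.+ zero) d-1 _} 0<q = contradiction 0<q (ℚ.<-irrefl (sym (ℚ.↥p≡0⇒p≡0 _ refl)))
archimedean {mkℚ (ℤ.-[1+ m ]) d-1 _} (ℚ.*<* ())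
-- The witness is the denominator of `q`; the product is then the numerator, which is at least 1.
archimedean {q@(mkℚ (ℤ.+ (suc m)) d-1 _)} _ = suc d-1 , ℚ.toℚᵘ-cancel-≤
  (ℚᵘ.≤-respʳ-≃ (ℚᵘ.≃-sym (ℚᵘ.≃-trans (ℚ.toℚᵘ-homo-* (fromℕ (suc d-1)) q)
                             (ℚᵘ.*-congʳ (toℚᵘ-fromℕ (suc d-1)))))
    (ℚᵘ.*≤* (ℤ.+≤+ (bound d-1 m))))
  where
  bound : ∀ d m → 1 ℕ.* (1 ℕ.* suc d) ℕ.≤ suc d ℕ.* suc m ℕ.* 1
  bound d m = subst (ℕ._≤ suc d ℕ.* suc m ℕ.* 1) (sym (trans (ℕ.*-identityˡ _) (ℕ.*-identityˡ _)))
    (subst (suc d ℕ.≤_) (sym (ℕ.*-identityʳ _)) (ℕ.m≤m*n (suc d) (suc m)))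

/₀-zeroʳ : ∀ p {q} → q ≡ 0ℚ → p /₀ q ≡ 0ℚ
/₀-zeroʳ p {q} q≡0 with q ≟ 0ℚ
... | yes _   = refl
... | no  q≢0 = contradiction q≡0 q≢0

/₀-*-cancel : ∀ p {q} → q ≢ 0ℚ → (p /₀ q) * q ≡ p
/₀-*-cancel p {q} q≢0 with q ≟ 0ℚ
... | yes q≡0 = contradiction q≡0 q≢0
... | no  q≢0 = trans (ℚ.*-assoc p _ q)
  (trans (cong (p *_) (ℚ.*-inverseˡ q {{≢-nonZero q≢0}})) (ℚ.*-identityʳ p))

1/-nonNeg : ∀ {q} (q≢0 : q ≢ 0ℚ) → 0ℚ ≤ q → ℚ.NonNegative ((1/ q) {{≢-nonZero q≢0}})
1/-nonNeg {q} q≢0 0≤q = ℚ.pos⇒nonNeg ((1/ q) {{≢-nonZero q≢0}}) {{ℚ.1/pos⇒pos q {{q>0}}}}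
  where q>0 = ℚ.nonNeg∧nonZero⇒pos q {{ℚ.nonNegative 0≤q}} {{≢-nonZero q≢0}}

/₀-mono : ∀ c {p r q} → 0ℚ ≤ q → p ≤ c * r → p /₀ q ≤ c * (r /₀ q)
/₀-mono c {p} {r} {q} 0≤q p≤cr with q ≟ 0ℚ
-- Both quotients take the default value 0.
... | yes _   = ℚ.≤-reflexive (sym (ℚ.*-zeroʳ c))
... | no  q≢0 =
  ℚ.≤-trans (ℚ.*-monoʳ-≤-nonNeg q⁻¹ {{1/-nonNeg q≢0 0≤q}} p≤cr)
            (ℚ.≤-reflexive (ℚ.*-assoc c r q⁻¹))
  where q⁻¹ = (1/ q) {{≢-nonZero q≢0}}

/₀-nonNeg : ∀ {p q} → 0ℚ ≤ p → 0ℚ ≤ q → ℚ.NonNegative (p /₀ q)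
/₀-nonNeg {p} {q} 0≤p 0≤q with q ≟ 0ℚ
... | yes _   = _
... | no  q≢0 = ℚ.nonNeg*nonNeg⇒nonNeg p {{ℚ.nonNegative 0≤p}}
                  ((1/ q) {{≢-nonZero q≢0}}) {{1/-nonNeg q≢0 0≤q}}

-- Clears denominators in a conditional probability: `o` counts the conditioning event, `m` its
-- intersection with the other event, and `t` all `k`-sets.
ratio-bound : ∀ {q} a m o t → 0ℚ < q → 1ℚ ≤ fromℕ a * q →
              q ≤ (fromℕ m /₀ fromℕ t) /₀ (fromℕ o /₀ fromℕ t) → o ℕ.≤ a ℕ.* m
ratio-bound {q} a m o t 0<q 1≤aq q≤x/y = fromℕ-cancel-≤ o (a ℕ.* m) (begin
  fromℕ o
    ≡⟨ sym (ℚ.*-identityˡ (fromℕ o)) ⟩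
  1ℚ * fromℕ o
    ≤⟨ ℚ.*-monoʳ-≤-nonNeg (fromℕ o) {{ℚ.nonNegative (0≤fromℕ o)}} 1≤aq ⟩
  fromℕ a * q * fromℕ o
    ≡⟨ cong (fromℕ a * q *_) (sym (/₀-*-cancel (fromℕ o) t≢0)) ⟩
  fromℕ a * q * (y * fromℕ t)
    ≡⟨ trans (ℚ.*-assoc (fromℕ a) q _) (cong (fromℕ a *_) (sym (ℚ.*-assoc q y (fromℕ t)))) ⟩
  fromℕ a * (q * y * fromℕ t)
    ≤⟨ ℚ.*-monoˡ-≤-nonNeg (fromℕ a) {{ℚ.nonNegative (0≤fromℕ a)}}
         (ℚ.*-monoʳ-≤-nonNeg (fromℕ t) {{ℚ.nonNegative (0≤fromℕ t)}}
           (ℚ.*-monoʳ-≤-nonNeg y {{/₀-nonNeg (0≤fromℕ o) (0≤fromℕ t)}} q≤x/y)) ⟩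
  fromℕ a * ((x /₀ y) * y * fromℕ t)
    ≡⟨ cong (λ z → fromℕ a * (z * fromℕ t)) (/₀-*-cancel x y≢0) ⟩
  fromℕ a * (x * fromℕ t)
    ≡⟨ cong (fromℕ a *_) (/₀-*-cancel (fromℕ m) t≢0) ⟩
  fromℕ a * fromℕ m
    ≡⟨ sym (fromℕ-* a m) ⟩
  fromℕ (a ℕ.* m) ∎)
  where
  open ℚ.≤-Reasoning
  x = fromℕ m /₀ fromℕ t
  y = fromℕ o /₀ fromℕ t
  -- A zero denominator would give the quotient its default value 0, against `0 < q`; in turn
  -- `t = 0` would force `y = 0`.
  y≢0 : y ≢ 0ℚ
  y≢0 y≡0 = ℚ.<-irrefl refl (ℚ.<-≤-trans 0<q (subst (q ≤_) (/₀-zeroʳ x y≡0) q≤x/y))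
  t≢0 : fromℕ t ≢ 0ℚ
  t≢0 t≡0 = y≢0 (/₀-zeroʳ (fromℕ o) t≡0)

-- The constant, and the passage from counts to probabilities

n≤2^n : ∀ n → n ℕ.≤ 2 ^ n
n≤2^n zero    = ℕ.z≤n
n≤2^n (suc n) = ℕ.+-mono-≤ (ℕ.m^n>0 2 n) (ℕ.≤-trans (n≤2^n n) (ℕ.m≤m+n (2 ^ n) 0))

-- Since `a ≤ 2 ^ a`, the left side is at most 2 to the power `2a + 2d`. For `d ≥ 1` both 1 and `d`
-- are at most `d ^ 3`; at `d = 0` the exponent on the right would vanish.
constant-bound : ∀ a d → 1 ℕ.≤ d →
                 a ℕ.* a ℕ.* 2 ^ d ℕ.* 2 ^ d ℕ.≤ 2 ^ ((a ℕ.+ a ℕ.+ 2) ℕ.* d ^ 3)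
constant-bound a d@(suc _) _ = begin
  a ℕ.* a ℕ.* 2 ^ d ℕ.* 2 ^ d
    ≤⟨ ℕ.*-monoˡ-≤ (2 ^ d) (ℕ.*-monoˡ-≤ (2 ^ d) (ℕ.*-mono-≤ (n≤2^n a) (n≤2^n a))) ⟩
  2 ^ a ℕ.* 2 ^ a ℕ.* 2 ^ d ℕ.* 2 ^ d
    ≡⟨ sym (trans (ℕ.^-distribˡ-+-* 2 (a ℕ.+ a ℕ.+ d) d)
         (cong (ℕ._* 2 ^ d) (trans (ℕ.^-distribˡ-+-* 2 (a ℕ.+ a) d)
           (cong (ℕ._* 2 ^ d) (ℕ.^-distribˡ-+-* 2 a a))))) ⟩
  2 ^ (a ℕ.+ a ℕ.+ d ℕ.+ d)
    ≤⟨ ℕ.^-monoʳ-≤ 2 exponents ⟩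
  2 ^ ((a ℕ.+ a ℕ.+ 2) ℕ.* d ^ 3) ∎
  where
  open ℕ.≤-Reasoning
  collect : ∀ a d → a ℕ.+ a ℕ.+ d ℕ.+ d ≡ (a ℕ.+ a) ℕ.* 1 ℕ.+ 2 ℕ.* d
  collect = solve-∀
  exponents : a ℕ.+ a ℕ.+ d ℕ.+ d ℕ.≤ (a ℕ.+ a ℕ.+ 2) ℕ.* d ^ 3
  exponents = begin
    a ℕ.+ a ℕ.+ d ℕ.+ d
      ≡⟨ collect a d ⟩
    (a ℕ.+ a) ℕ.* 1 ℕ.+ 2 ℕ.* d
      ≤⟨ ℕ.+-mono-≤ (ℕ.*-monoʳ-≤ (a ℕ.+ a) (ℕ.m^n>0 d 3))
                    (ℕ.*-monoʳ-≤ 2 (ℕ.m≤m*n d (d ^ 2) {{ℕ.m^n≢0 d 2}})) ⟩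
    (a ℕ.+ a) ℕ.* d ^ 3 ℕ.+ 2 ℕ.* d ^ 3
      ≡⟨ sym (ℕ.*-distribʳ-+ (d ^ 3) (a ℕ.+ a) 2) ⟩
    (a ℕ.+ a ℕ.+ 2) ℕ.* d ^ 3 ∎

Pr-mono : ∀ n k K {E F : Pred (Subset n) 0ℓ} (E? : Decidable E) (F? : Decidable F) →
          ∑ (kSubsets n k) (λ S → ⟦ E? S ⟧) ℕ.≤ K ℕ.* ∑ (kSubsets n k) (λ S → ⟦ F? S ⟧) →
          Pr n k E? ≤ fromℕ K * Pr n k F?
Pr-mono n k K E? F? E≤CF =
  /₀-mono (fromℕ K) (0≤fromℕ (length L))
    (subst (fromℕ #E ≤_) (fromℕ-* K #F)
      (fromℕ-mono-≤ #E (K ℕ.* #F)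
        (subst₂ (λ u v → u ℕ.≤ K ℕ.* v)
          (sym (length-filter E? L)) (sym (length-filter F? L)) E≤CF)))
  where
  L = kSubsets n k
  #E = length (filter E? L)
  #F = length (filter F? L)

CondPr-bound : ∀ n k {q} a {E F : Pred (Subset n) 0ℓ} (E? : Decidable E) (F? : Decidable F) →
               0ℚ < q → 1ℚ ≤ fromℕ a * q → q ≤ CondPr n k E? F? →
               ∑ (kSubsets n k) (λ S → ⟦ F? S ⟧)
               ℕ.≤ a ℕ.* ∑ (kSubsets n k) (λ S → ⟦ E? S ⟧ ℕ.* ⟦ F? S ⟧)
CondPr-bound n k a E? F? 0<q 1≤aq q≤CondPr =
  subst₂ (λ u v → u ℕ.≤ a ℕ.* v) (length-filter F? L)
    (trans (length-filter (E? ∩? F?) L) (∑-cong L (λ S → ⟦⟧-× (E? S) (F? S))))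
    (ratio-bound a (length (filter (E? ∩? F?) L)) (length (filter F? L)) (length L)
      0<q 1≤aq q≤CondPr)
  where L = kSubsets n k

lemma1p4 : ∀ (c : ℝ) → Positive c →
    ∃[ A ] ∀ (d : ℕ) → 1 ℕ.≤ d →
    ∃[ C′ ] (C′ ≤ fromℕ (2 ^ (A ℕ.* d ^ 3))) ×
    (∀ (n k : ℕ) → d ℕ.≤ k → k ℕ.≤ n →
    ∀ (Y : Family n k) (B : Family n d) →
    (∀ I → I ∈ Member B → CondPr n k (member? Y) (I ⊆?_) ≥ᴿ c) →
    Pr n k (hits? B) ≤ C′ * Pr n k (member? Y))
lemma1p4 c 0<c =
  -- A rational `q` with `0 < q < c` exists because the lower cut is open. Both `q` and `a ≥ 1/q`
  -- are fixed before `d`, so `A` depends on `c` alone.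
  let q , 0<q , q<c = ℝ.lower-open c 0<c
      a , 1≤aq      = archimedean 0<q
      A             = a ℕ.+ a ℕ.+ 2
  in A , λ d 1≤d →
  let K = a ℕ.* a ℕ.* 2 ^ d ℕ.* 2 ^ d
  in fromℕ K , fromℕ-mono-≤ K (2 ^ (A ℕ.* d ^ 3)) (constant-bound a d 1≤d) ,
  λ n k d≤k k≤n Y B dense →
  Pr-mono n k K (hits? B) (member? Y)
    (counting-bound d≤k k≤n a (member? Y) (hits? B)
      (λ (I , I∈B , I⊆S) → I , ∈-filter⁺ (member? B) (∈-subsets I) I∈B , I⊆S)
      (All.map
        (λ {I} I∈B → uniform B I∈B ,
          CondPr-bound n k a (member? Y) (I ⊆?_) 0<q 1≤aq
            -- A conditional probability below `q` would lie in the lower cut of `c`, which the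
            -- density hypothesis denies.
            (ℚ.≮⇒≥ (λ CondPr<q → dense I I∈B (ℝ.lower-closed c CondPr<q q<c))))
        (All.all-filter (member? B) (subsets n))))
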